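{- For every integer $\ell \ge 4$, every $C_{\ell+1}$-free graph $G$ satisfies $\varphi(G) \ge \chi(G) - O_{\ell}(\ln \ln \chi(G))$, i.e. there is a function $g_\ell$ with $g_\ell(x)=O(\ln\ln x)$ as $x\to\infty$ (implicit constants depending only on $\ell$) such that $\varphi(G)\ge \chi(G)-g_\ell(\chi(G))$ for every $C_{\ell+1}$-free graph $G$.
   Context: All graphs are finite, simple and non-empty. $C_{\ell+1}$-free means $G$ contains no cycle of length exactly $\ell+1$ as a (not necessarily induced) subgraph. For a proper colouring $\sigma$ of $G$, $\varphi_\sigma(G)=\max_{H}\big(|\sigma(V(H))|-\chi(H)\big)$ over all induced subgraphs $H$ of $G$; the chromatic discrepancy is $\varphi(G)=\min_\sigma \varphi_\sigma(G)$ over all proper colourings $\sigma$ of $G$. -}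

module Defs where

open import Data.Nat using (ℕ; zero; suc; _≤_; _∸_)
open import Data.Bool using (Bool; true; false)
open import Data.Fin using (Fin; zero; suc; inject₁; fromℕ)
open import Data.Fin.Subset using (Subset; _∈_)
open import Data.Product using (Σ; ∃; ∃-syntax; _×_; _,_)
open import Relation.Binary.PropositionalEquality using (_≡_; _≢_)
open import Function.Definitions using (Injective)

record Graph (n : ℕ) : Set where
  field
    adj    : Fin n → Fin n → Bool
    sym    : ∀ u v → adj u v ≡ adj v u
    irrefl : ∀ v → adj v v ≡ false
open Graph public

ContainsCycle : ∀ {n} → Graph n → ℕ → Set
ContainsCycle {n} G zero = Data.Empty.⊥
  where import Data.Empty
ContainsCycle {n} G (suc ℓ) =
  Σ (Fin (suc ℓ) → Fin n) λ f →
    Injective _≡_ _≡_ f ×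
    (∀ (i : Fin ℓ) → adj G (f (inject₁ i)) (f (suc i)) ≡ true) ×
    (adj G (f (fromℕ ℓ)) (f zero) ≡ true)

ColourableOn : ∀ {n} → Graph n → Subset n → ℕ → Set
ColourableOn {n} G S k =
  Σ (Fin n → Fin k) λ c →
    ∀ u v → u ∈ S → v ∈ S → adj G u v ≡ true → c u ≢ c v

ChromaticNumberOn : ∀ {n} → Graph n → Subset n → ℕ → Set
ChromaticNumberOn G S k =
  ColourableOn G S k × (∀ j → ColourableOn G S j → k ≤ j)

ChromaticNumber : ∀ {n} → Graph n → ℕ → Set
ChromaticNumber {n} G k = ChromaticNumberOn G Data.Fin.Subset.⊤ k
  where import Data.Fin.Subset

Proper : ∀ {n} → Graph n → (Fin n → ℕ) → Set
Proper G σ = ∀ u v → adj G u v ≡ true → σ u ≢ σ v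

ImageSize : ∀ {n} → (Fin n → ℕ) → Subset n → ℕ → Set
ImageSize {n} σ S m =
  Σ (Fin m → ℕ) λ e →
    Injective _≡_ _≡_ e ×
    (∀ v → v ∈ S → ∃[ i ] e i ≡ σ v) ×
    (∀ i → ∃[ v ] (v ∈ S × σ v ≡ e i))

NonEmpty : ∀ {n} → Subset n → Set
NonEmpty {n} S = ∃[ v ] v ∈ S

-- φ_σ(G) ≡ d : maximum over non-empty induced subgraphs H = G[S] of
-- |σ(V(H))| − χ(H)  (this difference is always ≥ 0 for proper σ).
PhiSigma : ∀ {n} → Graph n → (Fin n → ℕ) → ℕ → Set
PhiSigma {n} G σ d =
  (∃[ S ] ∃[ m ] ∃[ k ]
     (NonEmpty S × ImageSize σ S m × ChromaticNumberOn G S k × m ∸ k ≡ d)) ×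
  (∀ S m k → NonEmpty S → ImageSize σ S m → ChromaticNumberOn G S k → m ∸ k ≤ d)

Phi : ∀ {n} → Graph n → ℕ → Set
Phi {n} G d =
  (∃[ σ ] (Proper G σ × PhiSigma G σ d)) ×
  (∀ σ d' → Proper G σ → PhiSigma G σ d' → d ≤ d')

{-# OPTIONS --safe #-}
module Submission where

-- Let σ be a proper colouring and call a set rainbow if σ is injective on it. It suffices to find a
-- rainbow set L with |L| ≥ χ − O(1) and χ(L) = O(ln ln χ).
--
-- Every subgraph of minimum degree ℓ contains long paths, so in a C_{ℓ+1}-free graph with ℓ ≥ 4 the
-- first and the second neighbourhood of a vertex x are ℓ-colourable. For N²(x), give each vertex a
-- parent in N(x): the ends of a path on ℓ − 2 vertices have equal parents (else it closes through
-- x), hence so do two neighbours of a vertex, and then a path on ℓ vertices closes through the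
-- common parent of its ends.
--
-- Let the current graph have chromatic number exactly y. If σ uses more than y² colours, pigeonhole
-- gives an independent rainbow set of size y. Otherwise, as long as some vertex x sees s colours,
-- collect a rainbow set D of s neighbours of x and delete its colours together with {x}, N(x) and
-- N(D): this gains s colours and lowers the chromatic number by at most s + 2ℓ + 1, and the
-- union of the sets D is ℓ-colourable since no edges run between them. When no vertex sees s
-- colours, Linial's colour reduction bounds the chromatic number of the rest. With s about y^(1/10)
-- all but O(y^(9/10)) of the chromatic number has been collected by an ℓ-colourable rainbow set, and
-- O(ln ln χ) such rounds reduce y to a constant.

open import Defs hiding (sym)
open import Data.Bool using (true)
import Data.Bool as Bool
open import Data.Nat
open import Data.Nat.Properties
open import Data.Nat.DivMod using (_/_; _%_; m≡m%n+[m/n]*n; m%n<n; m<n*o⇒m/o<n)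
open import Data.Nat.Logarithm using (⌊log₂_⌋; ⌊log₂⌋-mono-≤; ⌊log₂[2^n]⌋≡n)
open import Data.Nat.Tactic.RingSolver using (solve-∀)
open import Data.Fin using (Fin; zero; suc; toℕ; fromℕ; fromℕ<; inject₁)
import Data.Fin as Fin
import Data.Fin.Properties as Fin
open import Data.List using (List; []; _∷_; _++_; length; map; filter; take; allFin)
import Data.List as List
open import Data.List.Properties
  using (length-map; length-++; length-take; take-map; map-++; length-filter; filter-notAll;
         length-upTo)
open import Data.List.Membership.Propositional using (_∈_; _∉_; find)
open import Data.List.Relation.Binary.Subset.Propositional using (_⊆_)
open import Data.List.Relation.Unary.Unique.DecPropositional.Properties using (deduplicate-!)
open import Data.List.Membership.Propositional.Properties
open import Data.List.Relation.Unary.All as All using (All; []; _∷_)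
open import Data.List.Relation.Unary.Any as Any using (Any; here; there)
open import Data.List.Relation.Unary.Any.Properties using (lookup-index)
open import Data.List.Relation.Unary.All.Properties using (¬Any⇒All¬)
open import Data.List.Relation.Unary.AllPairs using (AllPairs; []; _∷_)
open import Data.List.Relation.Unary.Unique.Propositional using (Unique)
import Data.List.Relation.Unary.Unique.Propositional.Properties as Unique
import Data.List.Relation.Unary.AllPairs.Properties as AllPairs
open import Data.Vec using (Vec; []; _∷_; lookup; toList)
import Data.Vec as Vec
open import Data.Vec.Properties using ([]=⇒lookup; lookup⇒[]=; lookup∘tabulate)
open import Data.Fin.Subset using (Subset)
import Data.Fin.Subset as Subset
import Data.Vec.Membership.Propositional.Properties as VecMembership
open import Data.Product using (Σ; ∃; ∃-syntax; _×_; _,_; proj₁; proj₂)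
open import Data.Sum using (_⊎_; inj₁; inj₂)
open import Data.Empty using (⊥)
open import Function using (_∘_; id)
open import Function.Definitions using (Injective)
open import Relation.Nullary using (¬_; Dec; yes; no; does; contradiction; ¬?)
open import Relation.Nullary.Decidable
  using (decidable-stable; dec-true; _×-dec_; ¬¬-excluded-middle)
open import Relation.Unary using (Decidable)
open import Relation.Binary.Definitions using (tri<; tri≈; tri>)
open import Relation.Binary.PropositionalEquality

-- Pigeonhole principle, encodings of pairs, and lines.

-- If every index were spoiled, pigeonhole would give two indices spoiled by the same entry of `ys`,
-- against `once`.
unspoiled : ∀ {A : Set} {s} {R : Fin s → A → Set} → (∀ t y → Dec (R t y)) →
            ∀ {ys} → (∀ {t t′ y} → y ∈ ys → R t y → R t′ y → t ≡ t′) → length ys < s →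
            ∃[ t ] All (λ y → ¬ R t y) ys
unspoiled {s = s} {R} R? {ys} once lt =
  let t , ¬any = Fin.¬∀⟶∃¬ s (λ t → Any (R t) ys) (λ t → Any.any? (R? t) ys) notAll
  in t , ¬Any⇒All¬ ys ¬any
  where
  notAll : ¬ (∀ t → Any (R t) ys)
  notAll all with t , t′ , t<t′ , eq ← Fin.pigeonhole lt (λ t → Any.index (all t))
    = Fin.<⇒≢ t<t′ (once (∈-lookup {xs = ys} _) (lookup-index (all t))
        (subst (λ i → R t′ (List.lookup ys i)) (sym eq) (lookup-index (all t′))))

lookup-injective : ∀ {A B : Set} (f : A → B) {xs} → AllPairs (λ x y → f x ≢ f y) xs →
                   ∀ {i j} → f (List.lookup xs i) ≡ f (List.lookup xs j) → i ≡ j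
lookup-injective f (_ ∷ _)    {zero}  {zero}  _  = refl
lookup-injective f (x≢ ∷ _)   {zero}  {suc j} eq = contradiction eq (All.lookup x≢ (∈-lookup j))
lookup-injective f (x≢ ∷ _)   {suc i} {zero}  eq = contradiction (sym eq) (All.lookup x≢ (∈-lookup i))
lookup-injective f (_ ∷ uniq) {suc i} {suc j} eq = cong suc (lookup-injective f uniq eq)

escape : ∀ {A : Set} → (∀ (x y : A) → Dec (x ≡ y)) →
         ∀ {xs ys : List A} → Unique xs → length ys < length xs → ∃[ x ] (x ∈ xs × x ∉ ys)
escape _≟A_ {xs} {ys} uniq lt
  with t , ¬R ← unspoiled (λ t y → List.lookup xs t ≟A y)
                  (λ _ p q → lookup-injective id uniq (trans p (sym q))) lt
  = List.lookup xs t , ∈-lookup t , λ x∈ys → All.lookup ¬R x∈ys refl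

position : List ℕ → ℕ → ℕ
position []       _ = 0
position (c ∷ cs) d with d ≟ c
... | yes _ = 0
... | no  _ = suc (position cs d)

position-< : ∀ {cs d} → d ∈ cs → position cs d < length cs
position-< {c ∷ cs} {d} d∈ with d ≟ c | d∈
... | yes _   | _         = z<s
... | no  d≢c | here d≡c  = contradiction d≡c d≢c
... | no  _   | there d∈′ = s<s (position-< d∈′)

position-injective : ∀ {cs d e} → d ∈ cs → e ∈ cs → position cs d ≡ position cs e → d ≡ e
position-injective {c ∷ cs} {d} {e} d∈ e∈ eq with d ≟ c | e ≟ c | d∈ | e∈
... | yes p | yes q | _        | _        = trans p (sym q)
... | no  p | _     | here q   | _        = contradiction q p
... | _     | no  p | _        | here q   = contradiction q p
... | no  _ | no  _ | there d∈′ | there e∈′ = position-injective d∈′ e∈′ (suc-injective eq)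

encode-mono : ∀ {B a a′ b b′} → a < a′ → b < B → a * B + b < a′ * B + b′
encode-mono {B} {a} {a′} {b} {b′} a<a′ b<B = begin-strict
  a * B + b   <⟨ +-monoʳ-< (a * B) b<B ⟩
  a * B + B   ≡⟨ +-comm (a * B) B ⟩
  suc a * B   ≤⟨ *-monoˡ-≤ B a<a′ ⟩
  a′ * B      ≤⟨ m≤m+n _ b′ ⟩
  a′ * B + b′ ∎
  where open ≤-Reasoning

encode-injective : ∀ {B a a′ b b′} → b < B → b′ < B → a * B + b ≡ a′ * B + b′ → a ≡ a′ × b ≡ b′
encode-injective {B} {a} {a′} {b} {b′} b<B b′<B eq with <-cmp a a′
... | tri< a<a′ _ _ = contradiction eq (<⇒≢ (encode-mono a<a′ b<B))
... | tri≈ _ refl _ = refl , +-cancelˡ-≡ (a * B) b b′ eq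
... | tri> _ _ a>a′ = contradiction (sym eq) (<⇒≢ (encode-mono a>a′ b′<B))

encode-< : ∀ {A B a b} → a < A → b < B → a * B + b < A * B
encode-< {A} {B} {a} {b} a<A b<B = begin-strict
  a * B + b <⟨ +-monoʳ-< (a * B) b<B ⟩
  a * B + B ≡⟨ +-comm (a * B) B ⟩
  suc a * B ≤⟨ *-monoˡ-≤ B a<A ⟩
  A * B     ∎
  where open ≤-Reasoning

-- c = x + m y is read as the line t ↦ x + t y; distinct lines meet at most once.
line : (m : ℕ) .{{_ : NonZero m}} → ℕ → ℕ → ℕ
line m t c = c % m + t * (c / m)

line-< : ∀ m .{{_ : NonZero m}} {s t c} → t < s → c < m * m → line m t c < s * m
line-< m {s} {t} {c} t<s c<mm = begin-strict
  c % m + t * (c / m) <⟨ +-monoˡ-< _ (m%n<n c m) ⟩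
  m + t * (c / m)     ≤⟨ +-monoʳ-≤ m (*-monoʳ-≤ t (<⇒≤ (m<n*o⇒m/o<n {c} {m} {m} c<mm))) ⟩
  suc t * m           ≤⟨ *-monoˡ-≤ m t<s ⟩
  s * m               ∎
  where open ≤-Reasoning

-- With `y′` written as `suc y + k`, cancelling `t * y` leaves `x ≡ x′ + t * suc k`. The same holds
-- for `t′`, so the two multiples of `suc k` agree.
lines-meet : ∀ {x x′ y y′ t t′} → y < y′ → x + t * y ≡ x′ + t * y′ → x + t′ * y ≡ x′ + t′ * y′ → t ≡ t′
lines-meet {x} {x′} {y} {y′} {t} {t′} y<y′ p q with k , refl ← m≤n⇒∃[o]m+o≡n y<y′
  = *-cancelʳ-≡ t t′ (suc k) (+-cancelˡ-≡ x′ _ _ (trans (sym (reduce t p)) (reduce t′ q)))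
  where
  split : ∀ x t y k → x + t * (suc y + k) ≡ (x + t * suc k) + t * y
  split = solve-∀
  reduce : ∀ t → x + t * y ≡ x′ + t * (suc y + k) → x ≡ x′ + t * suc k
  reduce t p = +-cancelʳ-≡ (t * y) x _ (trans p (split x′ t y k))

line-meet : ∀ m .{{_ : NonZero m}} {t t′ c c′} → c ≢ c′ →
            line m t c ≡ line m t c′ → line m t′ c ≡ line m t′ c′ → t ≡ t′
line-meet m {t} {t′} {c} {c′} c≢c′ eq eq′ with <-cmp (c / m) (c′ / m)
... | tri< lt _ _ = lines-meet lt eq eq′
-- Parallel lines that meet coincide, and `c` is recovered from its remainder and quotient.
... | tri≈ _ p _ = contradiction
  (trans (m≡m%n+[m/n]*n c m) (trans (cong₂ (λ x y → x + y * m) same p) (sym (m≡m%n+[m/n]*n c′ m)))) c≢c′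
  where
  same : c % m ≡ c′ % m
  same = +-cancelʳ-≡ (t * (c / m)) _ _ (trans eq (cong (λ y → c′ % m + t * y) (sym p)))
... | tri> _ _ gt = lines-meet gt (sym eq) (sym eq′)

-- Each colour other than `c` meets the line of `c` for at most one `t`, so fewer than `s` of them
-- leave a good `t` among `s` candidates.
separate : ∀ m .{{_ : NonZero m}} {s} c cs → length cs < s →
           ∃[ t ] (t < s × (∀ {c′} → c′ ∈ cs → c′ ≢ c → line m t c′ ≢ line m t c))
separate m {s} c cs lt
  with t , ¬R ← unspoiled {s = s} {λ t c′ → c′ ≢ c × line m (toℕ t) c′ ≡ line m (toℕ t) c}
                  (λ t c′ → ¬? (c′ ≟ c) ×-dec (line m (toℕ t) c′ ≟ line m (toℕ t) c))
                  (λ { _ (≢c , p) (_ , q) → Fin.toℕ-injective (line-meet m ≢c p q) }) lt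
  = toℕ t , Fin.toℕ<n t , λ c′∈ ≢c eq → All.lookup ¬R c′∈ (≢c , eq)

-- One representative per colour, so `length D` counts the colours on `V`.
transversal : ∀ {A : Set} (σ : A → ℕ) V →
              ∃[ D ] (D ⊆ V × Unique (map σ D) × (∀ {v} → v ∈ V → σ v ∈ map σ D))
transversal σ [] = [] , id , [] , λ ()
transversal σ (v ∷ V) with transversal σ V
... | D , D⊆V , uniq , cover with Any.any? (σ v ≟_) (map σ D)
...   | yes σv∈ = D , there ∘ D⊆V , uniq ,
                  λ { (here refl) → σv∈ ; (there u∈) → cover u∈ }
...   | no  σv∉ = v ∷ D , (λ { (here refl) → here refl ; (there u∈) → there (D⊆V u∈) }) ,
                  ¬Any⇒All¬ _ σv∉ ∷ uniq ,
                  λ { (here refl) → here refl ; (there u∈) → there (cover u∈) }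

-- Colourings of vertex lists, degeneracy, and paths.

module Colouring {n} (G : Graph n) where

  open import Data.List.Membership.DecPropositional (Fin._≟_ {n}) using (_∈?_)

  V# : Set
  V# = Fin n

  _~_ : V# → V# → Set
  u ~ v = adj G u v ≡ true

  _~?_ : ∀ u v → Dec (u ~ v)
  u ~? v = adj G u v Bool.≟ true

  ~-sym : ∀ {u v} → u ~ v → v ~ u
  ~-sym {u} {v} = trans (Graph.sym G v u)

  ~-irrefl : ∀ {v} → ¬ v ~ v
  ~-irrefl {v} v~v with () ← trans (sym v~v) (irrefl G v)

  -- Deciding membership supplies one fixed proof of `v ∈ V`, so the choice depends on `v` alone;
  -- `default` fills in outside `V`.
  choose : ∀ {B : Set} {R : V# → B → Set} → B → ∀ V → (∀ {v} → v ∈ V → ∃ (R v)) →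
           Σ (V# → B) λ f → ∀ {v} → v ∈ V → R v (f v)
  choose {B} {R} default V pick = f , spec
    where
    f : V# → B
    f v with v ∈? V
    ... | yes v∈V = proj₁ (pick v∈V)
    ... | no  _   = default
    spec : ∀ {v} → v ∈ V → R v (f v)
    spec {v} v∈V with v ∈? V
    ... | yes v∈V = proj₂ (pick v∈V)
    ... | no  v∉V = contradiction v∈V v∉V

  -- Colours are bounded only on `V`, so the empty list is 0-colourable even in a graph with
  -- vertices.
  Colourable : List V# → ℕ → Set
  Colourable V k = Σ (V# → ℕ) λ c →
    (∀ {v} → v ∈ V → c v < k) × (∀ {u v} → u ∈ V → v ∈ V → u ~ v → c u ≢ c v)

  colourable-mono : ∀ {U V i j} → U ⊆ V → i ≤ j → Colourable V i → Colourable U j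
  colourable-mono U⊆V i≤j (c , bound , proper) =
    c , (λ v∈ → <-≤-trans (bound (U⊆V v∈)) i≤j) , λ u∈ v∈ → proper (U⊆V u∈) (U⊆V v∈)

  colourable-[] : ∀ {k} → Colourable [] k
  colourable-[] = (λ _ → 0) , (λ ()) , λ ()

  colourable-independent : ∀ {V} → (∀ {u v} → u ∈ V → v ∈ V → ¬ u ~ v) → Colourable V 1
  colourable-independent indep = (λ _ → 0) , (λ _ → z<s) , λ u∈ v∈ u~v _ → indep u∈ v∈ u~v

  colourable-partition : ∀ {P : V# → Set} (P? : Decidable P) {V i j} →
    Colourable (filter P? V) i → Colourable (filter (¬? ∘ P?) V) j → Colourable V (i + j)
  colourable-partition {P} P? {V} {i} {j} (c , c< , c≢) (d , d< , d≢) = e , e< , e≢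
    where
    e : V# → ℕ
    e v with P? v
    ... | yes _ = c v
    ... | no  _ = i + d v
    e< : ∀ {v} → v ∈ V → e v < i + j
    e< {v} v∈ with P? v
    ... | yes p = <-≤-trans (c< (∈-filter⁺ P? v∈ p)) (m≤m+n i j)
    ... | no ¬p = +-monoʳ-< i (d< (∈-filter⁺ (¬? ∘ P?) v∈ ¬p))
    e≢ : ∀ {u v} → u ∈ V → v ∈ V → u ~ v → e u ≢ e v
    e≢ {u} {v} u∈ v∈ u~v with P? u | P? v
    ... | yes p | yes q = c≢ (∈-filter⁺ P? u∈ p) (∈-filter⁺ P? v∈ q) u~v
    ... | yes p | no ¬q = <⇒≢ (<-≤-trans (c< (∈-filter⁺ P? u∈ p)) (m≤m+n i _))
    ... | no ¬p | yes q = >⇒≢ (<-≤-trans (c< (∈-filter⁺ P? v∈ q)) (m≤m+n i _))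
    ... | no ¬p | no ¬q = d≢ (∈-filter⁺ (¬? ∘ P?) u∈ ¬p) (∈-filter⁺ (¬? ∘ P?) v∈ ¬q) u~v
                          ∘ +-cancelˡ-≡ i _ _

  colourable-++ : ∀ {U V i j} → Colourable U i → Colourable V j → Colourable (U ++ V) (i + j)
  colourable-++ {U} {V} U-col V-col = colourable-partition (_∈? U)
    (colourable-mono (λ v∈ → proj₂ (∈-filter⁻ (_∈? U) {xs = U ++ V} v∈)) ≤-refl U-col)
    (colourable-mono outside ≤-refl V-col)
    where
    outside : filter (¬? ∘ (_∈? U)) (U ++ V) ⊆ V
    outside v∈ with ∈-filter⁻ (¬? ∘ (_∈? U)) {xs = U ++ V} v∈
    ... | v∈UV , v∉U with ∈-++⁻ U v∈UV
    ...   | inj₁ v∈U = contradiction v∈U v∉U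
    ...   | inj₂ v∈V = v∈V

  colourable-disjoint : ∀ {U V k} → (∀ {u v} → u ∈ U → v ∈ V → ¬ u ~ v) →
    Colourable U k → Colourable V k → Colourable (U ++ V) k
  colourable-disjoint {U} {V} {k} apart (c , c< , c≢) (d , d< , d≢) = e , e< , e≢
    where
    right : ∀ {v} → v ∉ U → v ∈ U ++ V → v ∈ V
    right v∉U v∈ with ∈-++⁻ U v∈
    ... | inj₁ v∈U = contradiction v∈U v∉U
    ... | inj₂ v∈V = v∈V
    e : V# → ℕ
    e v with v ∈? U
    ... | yes _ = c v
    ... | no  _ = d v
    e< : ∀ {v} → v ∈ U ++ V → e v < k
    e< {v} v∈ with v ∈? U
    ... | yes v∈U = c< v∈U
    ... | no  v∉U = d< (right v∉U v∈)
    e≢ : ∀ {u v} → u ∈ U ++ V → v ∈ U ++ V → u ~ v → e u ≢ e v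
    e≢ {u} {v} u∈ v∈ u~v with u ∈? U | v ∈? U
    ... | yes u∈U | yes v∈U = c≢ u∈U v∈U u~v
    ... | yes u∈U | no  v∉U = contradiction u~v (apart u∈U (right v∉U v∈))
    ... | no  u∉U | yes v∈U = contradiction (~-sym u~v) (apart v∈U (right u∉U u∈))
    ... | no  u∉U | no  v∉U = d≢ (right u∉U u∈) (right v∉U v∈) u~v

  -- At least `K` distinct neighbours in `W`, in the form in which paths are grown: any shorter list
  -- of forbidden vertices can be avoided.
  Rich : ℕ → List V# → V# → Set
  Rich K W v = ∀ F → length F < K → ∃[ w ] (w ∈ W × v ~ w × w ∉ F)

  Poor : ℕ → List V# → V# → Set
  Poor K W v = ∃[ F ] (length F < K × (∀ {w} → w ∈ W → v ~ w → w ∈ F))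

  rich⊎poor : ∀ K W v → Rich K W v ⊎ Poor K W v
  rich⊎poor K W v with K ≤? length (List.deduplicate Fin._≟_ (filter (v ~?_) W))
  ... | yes K≤ = inj₁ λ F F< →
          let w , w∈ , w∉ = escape Fin._≟_ (deduplicate-! Fin._≟_ (filter (v ~?_) W)) (<-≤-trans F< K≤)
              w∈W , v~w = ∈-filter⁻ (v ~?_) {xs = W} (∈-deduplicate⁻ Fin._≟_ (filter (v ~?_) W) w∈)
          in w , w∈W , v~w , w∉
  ... | no  K≰ = inj₂ (_ , ≰⇒> K≰ , λ w∈ v~w → ∈-deduplicate⁺ Fin._≟_ (∈-filter⁺ (v ~?_) w∈ v~w))

  Core : ℕ → List V# → Set
  Core K W = ∃[ W′ ] (W′ ⊆ W × (∃[ v ] v ∈ W′) × (∀ {v} → v ∈ W′ → Rich K W′ v))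

  -- The neighbours of `v` occupy fewer than `K` colours, which leaves a free colour `i` for `v`.
  colourable-extend : ∀ {K W v} → Poor K W v →
    Colourable (filter (¬? ∘ (Fin._≟ v)) W) K → Colourable W K
  colourable-extend {K} {W} {v} (F , F< , nbrs) (c , c< , c≢) with
    escape _≟_ (Unique.upTo⁺ K) (subst₂ _<_ (sym (length-map c F)) (sym (length-upTo K)) F<)
  ... | i , i∈ , i∉ = d , d< , d≢
    where
    W-v = filter (¬? ∘ (Fin._≟ v)) W
    keep : ∀ {u} → u ∈ W → u ≢ v → u ∈ W-v
    keep = ∈-filter⁺ (¬? ∘ (Fin._≟ v))
    fresh : ∀ {u} → u ∈ W → v ~ u → i ≢ c u
    fresh u∈ v~u refl = i∉ (∈-map⁺ c (nbrs u∈ v~u))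
    d : V# → ℕ
    d u with u Fin.≟ v
    ... | yes _ = i
    ... | no  _ = c u
    d< : ∀ {u} → u ∈ W → d u < K
    d< {u} u∈ with u Fin.≟ v
    ... | yes _  = ∈-upTo⁻ i∈
    ... | no u≢v = c< (keep u∈ u≢v)
    d≢ : ∀ {u w} → u ∈ W → w ∈ W → u ~ w → d u ≢ d w
    d≢ {u} {w} u∈ w∈ u~w with u Fin.≟ v | w Fin.≟ v
    ... | yes refl | yes refl = contradiction u~w ~-irrefl
    ... | yes refl | no  _    = fresh w∈ u~w
    ... | no  _    | yes refl = fresh u∈ (~-sym u~w) ∘ sym
    ... | no  u≢v  | no  w≢v  = c≢ (keep u∈ u≢v) (keep w∈ w≢v) u~w

  -- Degeneracy: poor vertices are removed one at a time. If the list runs out, putting them back in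
  -- reverse order colours greedily; otherwise a core remains. In `go`, `f` bounds the length.
  colourable⊎core : ∀ K W → Colourable W K ⊎ Core K W
  colourable⊎core K W = go (length W) W ≤-refl
    where
    go : ∀ f W → length W ≤ f → Colourable W K ⊎ Core K W
    go f [] _ = inj₁ colourable-[]
    go (suc f) W@(v ∷ _) W≤ with All.decide (rich⊎poor K W) W
    ... | inj₁ rich = inj₂ (W , id , (v , here refl) , All.lookup rich)
    ... | inj₂ poor with find poor
    ...   | u , u∈ , u-poor with go f (filter (¬? ∘ (Fin._≟ u)) W)
              (≤-trans (<⇒≤pred (filter-notAll (¬? ∘ (Fin._≟ u)) W (Any.map (λ { refl ¬p → ¬p refl }) u∈)))
                       (pred-mono-≤ W≤))
    ...     | inj₁ col = inj₁ (colourable-extend u-poor col)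
    ...     | inj₂ (W′ , W′⊆ , rest) =
                inj₂ (W′ , (λ w∈ → proj₁ (∈-filter⁻ (¬? ∘ (Fin._≟ u)) {xs = W} (W′⊆ w∈))) , rest)

  data Path : ∀ {m} → V# → V# → Vec V# (suc m) → Set where
    [_]     : ∀ v → Path v v (v ∷ [])
    _∷⟨_⟩_ : ∀ {m u v w} {vs : Vec V# (suc m)} →
              u ∉ toList vs → u ~ v → Path v w vs → Path u w (u ∷ vs)

  path-start : ∀ {m u w} {vs : Vec V# (suc m)} → Path u w vs → lookup vs zero ≡ u
  path-start [ _ ]        = refl
  path-start (_ ∷⟨ _ ⟩ _) = refl

  path-end : ∀ {m u w} {vs : Vec V# (suc m)} → Path u w vs → lookup vs (fromℕ m) ≡ w
  path-end [ _ ]        = refl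
  path-end (_ ∷⟨ _ ⟩ p) = path-end p

  start∈ : ∀ {m u w} {vs : Vec V# (suc m)} → Path u w vs → u ∈ toList vs
  start∈ [ _ ]        = here refl
  start∈ (_ ∷⟨ _ ⟩ _) = here refl

  path-injective : ∀ {m u w} {vs : Vec V# (suc m)} → Path u w vs → Injective _≡_ _≡_ (lookup vs)
  path-injective [ _ ] {zero} {zero} _ = refl
  path-injective (_ ∷⟨ _ ⟩ _) {zero} {zero} _ = refl
  path-injective {vs = _ ∷ vs} (u∉ ∷⟨ _ ⟩ _) {zero} {suc j} refl =
    contradiction (VecMembership.∈-toList⁺ (VecMembership.∈-lookup j vs)) u∉
  path-injective {vs = _ ∷ vs} (u∉ ∷⟨ _ ⟩ _) {suc i} {zero} refl =
    contradiction (VecMembership.∈-toList⁺ (VecMembership.∈-lookup i vs)) u∉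
  path-injective (_ ∷⟨ _ ⟩ p) {suc i} {suc j} eq = cong suc (path-injective p eq)

  path-step : ∀ {m u w} {vs : Vec V# (suc m)} → Path u w vs →
              ∀ i → lookup vs (inject₁ i) ~ lookup vs (suc i)
  path-step (_∷⟨_⟩_ {u = u} _ u~v p) zero = subst (u ~_) (sym (path-start p)) u~v
  path-step (_ ∷⟨ _ ⟩ p) (suc i) = path-step p i

  close : ∀ {m u w} {vs : Vec V# (suc m)} → Path u w vs → w ~ u → ContainsCycle G (suc m)
  close {vs = vs} p w~u = lookup vs , path-injective p , path-step p ,
    subst₂ _~_ (sym (path-end p)) (sym (path-start p)) w~u

  -- `F` lists the vertices to avoid and gains the current one at each of the `m` steps, so it stays
  -- short enough for richness to offer a new neighbour.
  grow : ∀ {K W} → (∀ {v} → v ∈ W → Rich K W v) → ∀ m {u} F → u ∈ W → u ∉ F → length F + m < K →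
         ∃[ z ] ∃[ vs ] (Path {m} u z vs × z ∈ W × (∀ {v} → v ∈ toList vs → v ∈ W × v ∉ F))
  grow rich zero {u} F u∈ u∉ _ =
    u , u ∷ [] , [ u ] , u∈ , λ { (here refl) → u∈ , u∉ }
  grow {K} rich (suc m) {u} F u∈ u∉ F<
    with F<′ ← subst (_< K) (+-suc (length F) m) F<
    with v , v∈ , u~v , v∉ ← rich u∈ (u ∷ F) (≤-<-trans (m≤m+n _ m) F<′)
    with z , vs , p , z∈ , vs⊆ ← grow rich m (u ∷ F) v∈ v∉ F<′
    = z , u ∷ vs , (λ u∈vs → proj₂ (vs⊆ u∈vs) (here refl)) ∷⟨ u~v ⟩ p , z∈ ,
      λ { (here refl) → u∈ , u∉ ; (there w∈) → proj₁ (vs⊆ w∈) , proj₂ (vs⊆ w∈) ∘ there }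

  -- First and second neighbourhoods.

  -- A core would contain a path on `suc m` vertices inside N(x); joining both ends to `x` closes
  -- the forbidden cycle.
  neighbourhood-colourable : ∀ {m} → ¬ ContainsCycle G (suc (suc m)) →
    ∀ x W → (∀ {w} → w ∈ W → x ~ w) → Colourable W (suc m)
  neighbourhood-colourable {m} acyclic x W x~ with colourable⊎core (suc m) W
  ... | inj₁ col = col
  ... | inj₂ (W′ , W′⊆W , (v , v∈) , rich)
    with z , vs , p , z∈ , vs⊆ ← grow rich m [] v∈ (λ ()) (n<1+n m)
    = contradiction (close ((λ x∈ → ~-irrefl (x~ (W′⊆W (proj₁ (vs⊆ x∈))))) ∷⟨ x~ (W′⊆W v∈) ⟩ p)
                           (~-sym (x~ (W′⊆W z∈))))
                    acyclic

  -- Here `a` stands for ℓ - 4. The list `W` plays the part of a core at distance two from `x`, and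
  -- `empty` refutes its having a vertex.
  module SecondNeighbourhood {a} (acyclic : ¬ ContainsCycle G (5 + a)) {x W} (parent : V# → V#)
    (x≁ : ∀ {w} → w ∈ W → ¬ x ~ w)
    (x∉W : x ∉ W)
    (x~parent : ∀ {w} → w ∈ W → x ~ parent w)
    (parent~ : ∀ {w} → w ∈ W → parent w ~ w)
    (rich : ∀ {w} → w ∈ W → Rich (4 + a) W w)
    where

    _inW : ∀ {m} → Vec V# m → Set
    vs inW = ∀ {v} → v ∈ toList vs → v ∈ W

    parent∉ : ∀ {m w} {vs : Vec V# m} → vs inW → w ∈ W → parent w ∉ toList vs
    parent∉ vs⊆ w∈ p∈ = x≁ (vs⊆ p∈) (x~parent w∈)

    -- Distinct parents would extend the path by `parent u`, `x` and `parent z` to a cycle on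
    -- `(2 + a) + 3` vertices.
    same-parent-ends : ∀ {u z} {vs : Vec V# (2 + a)} → Path u z vs → u ∈ W → z ∈ W → vs inW →
                       parent u ≡ parent z
    same-parent-ends {u} {z} {vs} p u∈ z∈ vs⊆ = decidable-stable (parent u Fin.≟ parent z) λ pu≢pz →
      acyclic (close
        ((λ { (here pz≡x) → ~-irrefl (subst (x ~_) pz≡x (x~parent z∈))
            ; (there (here pz≡pu)) → pu≢pz (sym pz≡pu)
            ; (there (there pz∈)) → parent∉ {vs = vs} vs⊆ z∈ pz∈ }) ∷⟨ ~-sym (x~parent z∈) ⟩
         ((λ { (here x≡pu) → ~-irrefl (subst (x ~_) (sym x≡pu) (x~parent u∈))
             ; (there x∈) → x∉W (vs⊆ x∈) }) ∷⟨ x~parent u∈ ⟩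
         (parent∉ {vs = vs} vs⊆ u∈ ∷⟨ parent~ u∈ ⟩ p)))
        (~-sym (parent~ z∈)))

    -- A path on `1 + a` vertices is grown from `u` avoiding `w` and `w′`. Prefixing either of them
    -- gives a path on `2 + a` vertices with the same end `z`, so both parents equal `parent z`.
    same-parent-siblings : ∀ {u w w′} → u ∈ W → w ∈ W → w′ ∈ W → u ~ w → u ~ w′ → parent w ≡ parent w′
    same-parent-siblings {u} {w} {w′} u∈ w∈ w′∈ u~w u~w′
      with z , vs , p , z∈ , vs⊆ ← grow rich a (w ∷ w′ ∷ []) u∈
             (λ { (here refl) → ~-irrefl u~w ; (there (here refl)) → ~-irrefl u~w′ })
             (n≤1+n _)
      = trans (via w∈ (λ v∈ → proj₂ (vs⊆ v∈) (here refl)) u~w)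
              (sym (via w′∈ (λ v∈ → proj₂ (vs⊆ v∈) (there (here refl))) u~w′))
      where
      via : ∀ {v} → v ∈ W → v ∉ toList vs → u ~ v → parent v ≡ parent z
      via v∈ v∉ u~v = same-parent-ends (v∉ ∷⟨ ~-sym u~v ⟩ p) v∈ z∈
        λ { (here refl) → v∈ ; (there y∈) → proj₁ (vs⊆ y∈) }

    -- On a path `v`, `v₂`, `v₃`, ..., `z` with `4 + a` vertices, `v` and `v₃` are siblings, and the
    -- part from `v₃` to `z` has `2 + a` vertices. Hence `v` and `z` share a parent, which closes a
    -- cycle on `5 + a` vertices.
    empty : ∀ {v} → v ∉ W
    empty {v} v∈ with grow rich (3 + a) [] v∈ (λ ()) (n<1+n _)
    ... | z , vs , p@(_∷⟨_⟩_ {v = v₂} _ v~v₂ (_∷⟨_⟩_ {v = v₃} {vs = vs₃} _ v₂~v₃ q)) , z∈ , vs⊆ =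
      acyclic (close (parent∉ {vs = vs} (proj₁ ∘ vs⊆) v∈ ∷⟨ parent~ v∈ ⟩ p)
                     (subst (z ~_) (sym same-parent) (~-sym (parent~ z∈))))
      where
      v₃∈ : v₃ ∈ W
      v₃∈ = proj₁ (vs⊆ (there (there (start∈ q))))
      same-parent : parent v ≡ parent z
      same-parent = trans
        (same-parent-siblings (proj₁ (vs⊆ (there (here refl)))) v∈ v₃∈ (~-sym v~v₂) v₂~v₃)
        (same-parent-ends q v₃∈ z∈ (λ y∈ → proj₁ (vs⊆ (there (there y∈)))))

  second-neighbourhood-colourable : ∀ {a} → ¬ ContainsCycle G (5 + a) →
    ∀ x D W → (∀ {d} → d ∈ D → x ~ d) → (∀ {w} → w ∈ W → ¬ x ~ w × w ≢ x × Any (_~ w) D) →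
    Colourable W (4 + a)
  second-neighbourhood-colourable {a} acyclic x D W x~D W-spec with colourable⊎core (4 + a) W
  ... | inj₁ col = col
  ... | inj₂ (W′ , W′⊆W , (v , v∈) , rich)
    -- Any neighbour in `D` serves as parent; `x` is a mere default outside `W`.
    with parent , spec ← choose {R = λ w d → d ∈ D × d ~ w} x W
           (λ w∈ → find (proj₂ (proj₂ (W-spec w∈))))
    = contradiction v∈ (SecondNeighbourhood.empty acyclic parent
        (λ w∈ → proj₁ (W-spec (W′⊆W w∈)))
        (λ x∈ → proj₁ (proj₂ (W-spec (W′⊆W x∈))) refl)
        (λ w∈ → x~D (proj₁ (spec (W′⊆W w∈))))
        (λ w∈ → proj₂ (spec (W′⊆W w∈)))
        rich)

length-split : ∀ {A : Set} {P : A → Set} (P? : Decidable P) xs →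
               length xs ≡ length (filter P? xs) + length (filter (¬? ∘ P?) xs)
length-split P? [] = refl
length-split P? (x ∷ xs) with P? x
... | yes _ = cong suc (length-split P? xs)
... | no  _ = trans (cong suc (length-split P? xs)) (sym (+-suc _ _))

-- Rainbow lists, colour reduction and harvesting.

module Discrepancy {n} (G : Graph n) (σ : Fin n → ℕ) (proper : Proper G σ) where

  open Colouring G

  Rainbow : List V# → Set
  Rainbow L = Unique (map σ L)

  Coloured : List V# → List ℕ → Set
  Coloured V cs = ∀ {v} → v ∈ V → σ v ∈ cs

  -- `σ` itself, renumbered. This prices the deletion of colour classes: one unit of chromatic
  -- number per colour.
  colourable-by-colours : ∀ {V cs} → Coloured V cs → Colourable V (length cs)
  colourable-by-colours {cs = cs} col = position cs ∘ σ , position-< ∘ col ,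
    λ u∈ v∈ u~v eq → proper _ _ u~v (position-injective (col u∈) (col v∈) eq)

  SeesFew : ℕ → List V# → V# → Set
  SeesFew s V v = ∃[ F ] (length F < s × (∀ {w} → w ∈ V → v ~ w → σ w ∈ F))

  SeesMany : ℕ → List V# → V# → Set
  SeesMany s V v = ∃[ D ] (D ⊆ V × (∀ {d} → d ∈ D → v ~ d) × Rainbow D × length D ≡ s)

  few⊎many : ∀ s V v → SeesFew s V v ⊎ SeesMany s V v
  few⊎many s V v with transversal σ (filter (v ~?_) V)
  ... | D , D⊆ , rainbow , cover with s ≤? length D
  ...   | no  s≰ = inj₁ (map σ D , subst (_< s) (sym (length-map σ D)) (≰⇒> s≰) ,
                         λ w∈ v~w → cover (∈-filter⁺ (v ~?_) w∈ v~w))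
  -- Cutting to exactly `s` makes the total after `T` rounds exactly `T * s`.
  ...   | yes s≤ = inj₂ (take s D , (λ d∈ → proj₁ (D-spec d∈)) , (λ d∈ → proj₂ (D-spec d∈)) ,
                         subst Unique (take-map s D) (Unique.take⁺ s rainbow) ,
                         trans (length-take s D) (m≤n⇒m⊓n≡m s≤))
    where
    take⊆ : ∀ k (xs : List V#) → take k xs ⊆ xs
    take⊆ (suc k) (x ∷ xs) (here refl) = here refl
    take⊆ (suc k) (x ∷ xs) (there x∈)  = there (take⊆ k xs x∈)
    D-spec : ∀ {d} → d ∈ take s D → d ∈ V × v ~ d
    D-spec d∈ = ∈-filter⁻ (v ~?_) {xs = V} (D⊆ (take⊆ s D d∈))

  -- Linial's colour reduction, applied twice: the choice of the two slopes t₁ and t₂ at a vertex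
  -- becomes part of its new colour.
  colourable-sparse : ∀ s m₁ m₂ .{{_ : NonZero m₁}} .{{_ : NonZero m₂}} {V cs} →
    length cs ≤ m₁ * m₁ → s * m₁ ≤ m₂ * m₂ → Coloured V cs →
    (∀ {v} → v ∈ V → SeesFew s V v) → Colourable V (s * s * (s * m₂))
  colourable-sparse s m₁ m₂ {V} {cs} cs≤ sm₁≤ col few =
    let f , spec = choose {R = Good} (0 , 0) V pick
    in c f , (λ v∈ → c< f v∈ (spec v∈)) , c≢ f spec
    where
    ρ : V# → ℕ
    ρ v = position cs (σ v)

    ρ< : ∀ {v} → v ∈ V → ρ v < m₁ * m₁
    ρ< v∈ = <-≤-trans (position-< (col v∈)) cs≤

    ρ₂ : ℕ × ℕ → V# → ℕ
    ρ₂ (t₁ , t₂) v = line m₂ t₂ (line m₁ t₁ (ρ v))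

    Good : V# → ℕ × ℕ → Set
    Good v t = proj₁ t < s × proj₂ t < s × (∀ {w} → w ∈ V → v ~ w → ρ₂ t w ≢ ρ₂ t v)

    pick : ∀ {v} → v ∈ V → ∃ (Good v)
    pick {v} v∈
      with F , F< , seen ← few v∈
      with t₁ , t₁< , sep₁ ← separate m₁ (ρ v) (map (position cs) F)
             (subst (_< s) (sym (length-map _ F)) F<)
      -- The second choice must separate the images of the seen colours under the first.
      with t₂ , t₂< , sep₂ ← separate m₂ (line m₁ t₁ (ρ v)) (map (line m₁ t₁ ∘ position cs) F)
             (subst (_< s) (sym (length-map _ F)) F<)
      = (t₁ , t₂) , t₁< , t₂< , λ w∈ v~w →
          sep₂ (∈-map⁺ (line m₁ t₁ ∘ position cs) (seen w∈ v~w))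
               (sep₁ (∈-map⁺ (position cs) (seen w∈ v~w))
                     (proper _ _ (~-sym v~w) ∘ position-injective (col w∈) (col v∈)))

    slope c : (V# → ℕ × ℕ) → V# → ℕ
    slope f v = proj₁ (f v) * s + proj₂ (f v)
    c f v = slope f v * (s * m₂) + ρ₂ (f v) v

    ρ₂< : ∀ {v t} → v ∈ V → Good v t → ρ₂ t v < s * m₂
    ρ₂< v∈ (t₁< , t₂< , _) = line-< m₂ t₂< (<-≤-trans (line-< m₁ t₁< (ρ< v∈)) sm₁≤)

    c< : ∀ f {v} → v ∈ V → Good v (f v) → c f v < s * s * (s * m₂)
    c< f v∈ good@(t₁< , t₂< , _) = encode-< (encode-< t₁< t₂<) (ρ₂< v∈ good)

    c≢ : ∀ f → (∀ {v} → v ∈ V → Good v (f v)) → ∀ {u v} → u ∈ V → v ∈ V → u ~ v → c f u ≢ c f v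
    c≢ f spec {u} {v} u∈ v∈ u~v eq
      -- Equal codes mean equal slopes and equal values, yet the slopes chosen at `u` separate `u`
      -- from its neighbour `v`.
      with slopes , values ← encode-injective {a = slope f u} {slope f v} (ρ₂< u∈ (spec u∈)) (ρ₂< v∈ (spec v∈)) eq
      with t₁≡ , t₂≡ ← encode-injective {a = proj₁ (f u)} {proj₁ (f v)} (proj₁ (proj₂ (spec u∈))) (proj₁ (proj₂ (spec v∈))) slopes
      = proj₂ (proj₂ (spec u∈)) v∈ u~v
          (trans (cong (λ t → ρ₂ t v) (cong₂ _,_ t₁≡ t₂≡)) (sym values))

  module _ {a} (acyclic : ¬ ContainsCycle G (5 + a)) where

    private ℓ = 4 + a

    open import Data.List.Membership.DecPropositional _≟_ using () renaming (_∈?_ to _∈ᶜ?_)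

    -- Harvesting D costs its own colours and N(D) ⊆ {x} ∪ N(x) ∪ N²(x), which is (2ℓ + 1)-colourable.
    module Cut (x : V#) (D : List V#) (V : List V#) (x~D : ∀ {d} → d ∈ D → x ~ d) where

      used? : Decidable (λ v → σ v ∈ map σ D)
      used? v = σ v ∈ᶜ? map σ D

      attached? : Decidable (λ v → Any (_~ v) D)
      attached? v = Any.any? (_~? v) D

      V₁ V₂ V₃ V₄ : List V#
      V₁ = filter (¬? ∘ used?) V
      V₂ = filter (¬? ∘ (Fin._≟ x)) V₁
      V₃ = filter (¬? ∘ (x ~?_)) V₂
      V₄ = filter (¬? ∘ attached?) V₃

      V₂-spec : ∀ {v} → v ∈ V₂ → (v ∈ V × σ v ∉ map σ D) × v ≢ x
      V₂-spec v∈ with ∈-filter⁻ (¬? ∘ (Fin._≟ x)) {xs = V₁} v∈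
      ... | v∈₁ , v≢x = ∈-filter⁻ (¬? ∘ used?) {xs = V} v∈₁ , v≢x

      V₃-spec : ∀ {v} → v ∈ V₃ → v ∈ V₂ × ¬ x ~ v
      V₃-spec v∈ = ∈-filter⁻ (¬? ∘ (x ~?_)) {xs = V₂} v∈

      V₄-spec : ∀ {v} → v ∈ V₄ → v ∈ V₃ × ¬ Any (_~ v) D
      V₄-spec v∈ = ∈-filter⁻ (¬? ∘ attached?) {xs = V₃} v∈

      V₄-spec′ : ∀ {v} → v ∈ V₄ → v ∈ V × σ v ∉ map σ D
      V₄-spec′ v∈ = proj₁ (V₂-spec (proj₁ (V₃-spec (proj₁ (V₄-spec v∈)))))

      shorter : x ∈ V → length V₄ < length V
      shorter x∈V = begin-strict
        length V₄ ≤⟨ length-filter (¬? ∘ attached?) V₃ ⟩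
        length V₃ ≤⟨ length-filter (¬? ∘ (x ~?_)) V₂ ⟩
        length V₂ <⟨ filter-notAll (¬? ∘ (Fin._≟ x)) V₁ (Any.map (λ { refl ¬p → ¬p refl }) x∈V₁) ⟩
        length V₁ ≤⟨ length-filter (¬? ∘ used?) V ⟩
        length V  ∎
        where
        open ≤-Reasoning
        -- `x` differs in colour from its neighbours in `D`, so it survives into `V₁` and is dropped
        -- on passing to `V₂`.
        x-unused : σ x ∉ map σ D
        x-unused σx∈ with ∈-map⁻ σ σx∈
        ... | d , d∈ , eq = proper _ _ (x~D d∈) eq
        x∈V₁ : x ∈ V₁
        x∈V₁ = ∈-filter⁺ (¬? ∘ used?) x∈V x-unused

      recolour : ∀ {j} → Colourable V₄ j → Colourable V (length D + (1 + (ℓ + (ℓ + j))))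
      recolour V₄-col =
        colourable-partition used? colours (
        colourable-partition (Fin._≟ x) centre (
        colourable-partition (x ~?_) first (
        colourable-partition attached? second V₄-col)))
        where
        colours : Colourable (filter used? V) (length D)
        colours = subst (Colourable _) (length-map σ D)
          (colourable-by-colours (λ v∈ → proj₂ (∈-filter⁻ used? {xs = V} v∈)))
        centre : Colourable (filter (Fin._≟ x) V₁) 1
        centre = colourable-independent λ u∈ v∈ u~v →
          ~-irrefl (subst₂ _~_ (proj₂ (∈-filter⁻ (Fin._≟ x) {xs = V₁} u∈))
                               (proj₂ (∈-filter⁻ (Fin._≟ x) {xs = V₁} v∈)) u~v)
        first : Colourable (filter (x ~?_) V₂) ℓ
        first = neighbourhood-colourable acyclic x _ λ w∈ → proj₂ (∈-filter⁻ (x ~?_) {xs = V₂} w∈)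
        second : Colourable (filter attached? V₃) ℓ
        second = second-neighbourhood-colourable acyclic x D _ x~D λ w∈ →
          let w∈₃ , att = ∈-filter⁻ attached? {xs = V₃} w∈
              w∈₂ , x≁w = V₃-spec w∈₃
          in x≁w , proj₂ (V₂-spec w∈₂) , att

    -- `T` counts the rounds and `R` bounds the chromatic number of what is left after them.
    Harvest : ℕ → ℕ → List V# → Set
    Harvest s R V = ∃[ T ] ∃[ L ] (L ⊆ V × Rainbow L × Colourable L ℓ × length L ≡ T * s ×
                                   Colourable V (T * (s + (1 + (ℓ + ℓ))) + R))

    harvest : ∀ s m₁ m₂ .{{_ : NonZero m₁}} .{{_ : NonZero m₂}} {cs} →
      length cs ≤ m₁ * m₁ → s * m₁ ≤ m₂ * m₂ → ∀ V → Coloured V cs → Harvest s (s * s * (s * m₂)) V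
    harvest s m₁ m₂ {cs} cs≤ sm₁≤ V = go (length V) V ≤-refl
      where
      R = s * s * (s * m₂)
      go : ∀ f V → length V ≤ f → Coloured V cs → Harvest s R V
      stop : ∀ {V} → Coloured V cs → (∀ {v} → v ∈ V → SeesFew s V v) → Harvest s R V
      stop col few = 0 , [] , (λ ()) , [] , colourable-[] , refl ,
                     colourable-sparse s m₁ m₂ cs≤ sm₁≤ col few
      go zero    [] V≤ col = stop col λ ()
      go (suc f) V V≤ col with All.decide (few⊎many s V) V
      ... | inj₁ few  = stop col (All.lookup few)
      ... | inj₂ many
        with x , x∈ , D , D⊆V , x~D , D-rainbow , D-len ← find many
        with T , L , L⊆ , L-rainbow , L-col , L-len , V₄-col ←
               go f (Cut.V₄ x D V x~D) (≤-pred (<-≤-trans (Cut.shorter x D V x~D x∈) V≤))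
                 (λ v∈ → col (proj₁ (Cut.V₄-spec′ x D V x~D v∈)))
        = suc T , D ++ L , D++L⊆ , rainbow ,
          -- `D` lies in N(x), and N(D) was deleted before `L` was collected, so the same ℓ colours
          -- serve both.
          colourable-disjoint apart (neighbourhood-colourable acyclic x D x~D) L-col ,
          trans (length-++ D) (cong₂ _+_ D-len L-len) ,
          subst (Colourable V) (trans (cong (_+ _) D-len) (total T s ℓ R)) (recolour V₄-col)
        where
        open Cut x D V x~D
        total : ∀ T s ℓ R → s + (1 + (ℓ + (ℓ + (T * (s + (1 + (ℓ + ℓ))) + R)))) ≡
                            suc T * (s + (1 + (ℓ + ℓ))) + R
        total = solve-∀
        D++L⊆ : D ++ L ⊆ V
        D++L⊆ v∈ with ∈-++⁻ D v∈
        ... | inj₁ v∈D = D⊆V v∈D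
        ... | inj₂ v∈L = proj₁ (V₄-spec′ (L⊆ v∈L))
        rainbow : Rainbow (D ++ L)
        rainbow = subst Unique (sym (map-++ σ D L)) (Unique.++⁺ D-rainbow L-rainbow disjoint)
          where
          disjoint : ∀ {c} → ¬ (c ∈ map σ D × c ∈ map σ L)
          disjoint (c∈D , c∈L) with ∈-map⁻ σ c∈L
          ... | v , v∈L , refl = proj₂ (V₄-spec′ (L⊆ v∈L)) c∈D
        apart : ∀ {u v} → u ∈ D → v ∈ L → ¬ u ~ v
        apart u∈ v∈ u~v = proj₂ (V₄-spec (L⊆ v∈)) (Any.map (λ { refl → u~v }) u∈)

-- Logarithms, least values and the size of the remainder.

n≤2^n : ∀ n → n ≤ 2 ^ n
n≤2^n zero    = z≤n
n≤2^n (suc n) = begin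
  suc n         ≤⟨ +-mono-≤ (m^n>0 2 n) (n≤2^n n) ⟩
  2 ^ n + 2 ^ n ≡⟨ cong (2 ^ n +_) (sym (+-identityʳ _)) ⟩
  2 ^ suc n     ∎
  where open ≤-Reasoning

n<2^[1+⌊log₂n⌋] : ∀ n → n < 2 ^ suc ⌊log₂ n ⌋
n<2^[1+⌊log₂n⌋] n = ≰⇒> λ le →
  1+n≰n (subst (_≤ ⌊log₂ n ⌋) (⌊log₂[2^n]⌋≡n (suc ⌊log₂ n ⌋)) (⌊log₂⌋-mono-≤ le))

-- `P` need not be decidable, so excluded middle is used at each candidate under double negation.
-- The candidate `m` climbs from 0, with `r` the distance left to `j`.
least : ∀ (P : ℕ → Set) {j} → P j → ¬ ¬ (∃[ c ] (c ≤ j × P c × (∀ i → P i → c ≤ i)))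
least P {j} Pj k = go j 0 (sym (+-identityʳ j)) (λ _ _ → z≤n)
  where
  go : ∀ r m → j ≡ r + m → (∀ i → P i → m ≤ i) → ⊥
  go r m eq low = ¬¬-excluded-middle λ
    { (yes Pm) → k (m , subst (m ≤_) (sym eq) (m≤n+m m r) , Pm , low)
    ; (no ¬Pm) → next r eq (λ i Pi → ≤∧≢⇒< (low i Pi) λ { refl → ¬Pm Pi }) }
    where
    next : ∀ r → j ≡ r + m → (∀ i → P i → suc m ≤ i) → ⊥
    next zero    eq low = 1+n≰n (subst (suc m ≤_) eq (low j Pj))
    next (suc r) eq low = go r (suc m) (trans eq (sym (+-suc r m))) low

-- If `T * u < y`, then `y ≤ u ^ 10` forces `T < u ^ 9`, so the overhead `T * C` is below
-- `u ^ 9 * C`.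
leftover : ∀ u C T y .{{_ : NonZero u}} → y ≤ u ^ 10 → y ≤ T * (u + C) + u ^ 9 →
           y ∸ T * u ≤ u ^ 9 * suc C
leftover u C T y y≤ y≤T with T * u <? y
... | no  Tu≮y = subst (_≤ u ^ 9 * suc C) (sym (m≤n⇒m∸n≡0 (≮⇒≥ Tu≮y))) z≤n
... | yes Tu<y = begin
  y ∸ T * u         ≤⟨ m≤n+o⇒m∸n≤o y (T * u) (≤-trans y≤T (≤-reflexive (regroup T u C (u ^ 9)))) ⟩
  T * C + u ^ 9     ≤⟨ +-monoˡ-≤ (u ^ 9) (*-monoˡ-≤ C (<⇒≤ T<u⁹)) ⟩
  u ^ 9 * C + u ^ 9 ≡⟨ +-comm _ (u ^ 9) ⟩
  u ^ 9 + u ^ 9 * C ≡⟨ sym (*-suc (u ^ 9) C) ⟩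
  u ^ 9 * suc C     ∎
  where
  open ≤-Reasoning
  regroup : ∀ T u C x → T * (u + C) + x ≡ T * u + (T * C + x)
  regroup = solve-∀
  T<u⁹ : T < u ^ 9
  T<u⁹ = *-cancelˡ-< u T (u ^ 9) (subst (_< u ^ 10) (*-comm T u) (<-≤-trans Tu<y y≤))

-- Iterated extraction of a large rainbow list.

module Extraction {n} (G : Graph n) (σ : Fin n → ℕ) (proper : Proper G σ) where

  open Colouring G
  open Discrepancy G σ proper
  open import Data.List.Membership.DecPropositional _≟_ using () renaming (_∈?_ to _∈ᶜ?_)

  filter-rainbow : ∀ {P : V# → Set} (P? : Decidable P) {L} → Rainbow L → Rainbow (filter P? L)
  filter-rainbow P? rainbow = AllPairs.map⁺ (AllPairs.filter⁺ P? (AllPairs.map⁻ rainbow))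

  -- Pigeonhole by peeling off the top class: if it has at most `z` members, the rest is still too
  -- large for the remaining classes.
  large-class : ∀ y {z} (c : V# → ℕ) D → (∀ {v} → v ∈ D → c v < y) → Rainbow D → y * z < length D →
    ∃[ E ] (E ⊆ D × (∀ {u v} → u ∈ E → v ∈ E → c u ≡ c v) × Rainbow E × z < length E)
  large-class zero c (_ ∷ _) c< _ _ with () ← c< (here refl)
  large-class (suc y) {z} c D c< rainbow yz< with z <? length (filter (λ v → c v ≟ y) D)
  ... | yes z< = filter is? D , (λ v∈ → proj₁ (∈-filter⁻ is? {xs = D} v∈)) ,
        (λ u∈ v∈ → trans (proj₂ (∈-filter⁻ is? {xs = D} u∈)) (sym (proj₂ (∈-filter⁻ is? {xs = D} v∈)))) ,
        filter-rainbow is? rainbow , z<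
    where is? = λ v → c v ≟ y
  ... | no  z≮ =
        let E , E⊆ , rest = large-class y c D′
              (λ v∈ → ≤∧≢⇒< (≤-pred (c< (proj₁ (D′-spec v∈)))) (proj₂ (D′-spec v∈)))
              (filter-rainbow (¬? ∘ is?) rainbow)
              (+-cancelˡ-< z _ _ (<-≤-trans yz< (≤-trans (≤-reflexive (length-split is? D))
                (+-monoˡ-≤ (length D′) (≮⇒≥ z≮)))))
        in E , (λ v∈ → proj₁ (D′-spec (E⊆ v∈))) , rest
    where
    is? : ∀ v → Dec (c v ≡ y)
    is? v = c v ≟ y
    D′ = filter (¬? ∘ is?) D
    D′-spec : ∀ {v} → v ∈ D′ → v ∈ D × c v ≢ y
    D′-spec v∈ = ∈-filter⁻ (¬? ∘ is?) {xs = D} v∈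

  Lower : List V# → ℕ → Set
  Lower V y = ∀ {j} → Colourable V j → y ≤ j

  -- Vertices are dropped while the rest still needs `y` colours. When dropping `v` would leave
  -- fewer needed, a private colour for `v` gives a `y`-colouring, which `large-class` then divides
  -- into classes.
  trim : ∀ y V → Lower V y → ¬ ¬ (∃[ V′ ] (V′ ⊆ V × Colourable V′ y × Lower V′ y))
  trim zero    V       low k = k ([] , (λ ()) , colourable-[] , λ _ → z≤n)
  trim (suc y) []      low k with () ← low {0} colourable-[]
  trim (suc y) (v ∷ V) low k = ¬¬-excluded-middle λ
    { (yes col) → k (v ∷ V , id , colourable-++ (colourable-independent {v ∷ []} lonely) col , low)
    ; (no ¬col) → trim (suc y) V
        (λ col → ≰⇒> λ j≤y → ¬col (colourable-mono id j≤y col))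
        λ (V′ , V′⊆ , rest) → k (V′ , there ∘ V′⊆ , rest) }
    where
    lonely : ∀ {u w} → u ∈ v ∷ [] → w ∈ v ∷ [] → ¬ u ~ w
    lonely (here refl) (here refl) = ~-irrefl

  module _ {a} (acyclic : ¬ ContainsCycle G (5 + a)) (N₀ : ℕ) where

    private ℓ = 4 + a

    RainbowIn : List V# → ℕ → ℕ → Set
    RainbowIn V f y = ∃[ L ] (L ⊆ V × Rainbow L × Colourable L (f * ℓ) × y ≤ length L + N₀)

    -- The bound is a tenth power of `2 ^ e`, so the threshold near y^(1/10) is an exact power of
    -- two. `f` counts rounds, each costing ℓ colours.
    Extracts : ℕ → ℕ → Set
    Extracts e f = ∀ y V → y ≤ 2 ^ (10 * e) → Lower V y → ¬ ¬ RainbowIn V f y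

    -- With u = 2^e′ and y ≤ u¹⁰: if V′ has more than y² colours, a y-colouring of V′ has a class
    -- meeting more than y of them; otherwise one harvest with s = u leaves only O(u⁹) of y.
    advance : ∀ {c e e′ f} → suc (1 + (ℓ + ℓ)) ≤ 2 ^ c → 9 * e′ + c ≤ 10 * e →
              Extracts e f → Extracts e′ (suc f)
    advance {c} {e} {e′} {f} C≤ e≤ extract y V y≤ low k =
      trim y V low λ (V′ , V′⊆V , V′-col , V′-low) → split V′ V′⊆V V′-col V′-low (transversal σ V′)
      where
      open ≤-Reasoning
      u = 2 ^ e′
      instance
        u≢0 : NonZero u
        u≢0 = m^n≢0 2 e′
        u¹¹≢0 : NonZero (u ^ 11)
        u¹¹≢0 = m^n≢0 u 11
        u⁶≢0 : NonZero (u ^ 6)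
        u⁶≢0 = m^n≢0 u 6

      power : ∀ i → 2 ^ (i * e′) ≡ u ^ i
      power i = trans (cong (2 ^_) (*-comm i e′)) (sym (^-*-assoc 2 e′ i))

      y≤u¹⁰ : y ≤ u ^ 10
      y≤u¹⁰ = ≤-trans y≤ (≤-reflexive (power 10))

      y≤u¹¹ : y ≤ u ^ 11
      y≤u¹¹ = ≤-trans y≤u¹⁰ (m≤n*m (u ^ 10) u)

      split : ∀ V′ → V′ ⊆ V → Colourable V′ y → Lower V′ y →
              ∃[ D ] (D ⊆ V′ × Rainbow D × (∀ {v} → v ∈ V′ → σ v ∈ map σ D)) → ⊥
      split V′ V′⊆V V′-col@(c′ , c′< , c′≢) V′-low (D , D⊆V′ , D-rainbow , cover)
        with y * y <? length D
      ... | yes y²<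
        with E , E⊆D , mono , E-rainbow , y< ← large-class y c′ D (c′< ∘ D⊆V′) D-rainbow y²<
        = k (E , V′⊆V ∘ D⊆V′ ∘ E⊆D , E-rainbow ,
             colourable-mono id (s≤s z≤n) (colourable-independent λ u∈ v∈ u~v →
               c′≢ (D⊆V′ (E⊆D u∈)) (D⊆V′ (E⊆D v∈)) u~v (mono u∈ v∈)) ,
             ≤-trans (<⇒≤ y<) (m≤m+n _ N₀))
      ... | no y²≮
        with T , L , L⊆V′ , L-rainbow , L-col , L-len , V′-col′ ←
          -- `u ^ 11` instead of `u ^ 10` makes `u * u ^ 11` the square of `u ^ 6`; the sparse part
          -- then needs `u * u * (u * u ^ 6)`, that is `u ^ 9`, colours.
          harvest acyclic u (u ^ 11) (u ^ 6) {map σ D}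
            (begin
              length (map σ D) ≡⟨ length-map σ D ⟩
              length D         ≤⟨ ≮⇒≥ y²≮ ⟩
              y * y            ≤⟨ *-mono-≤ y≤u¹¹ y≤u¹¹ ⟩
              u ^ 11 * u ^ 11  ∎)
            (≤-reflexive (^-distribˡ-+-* u 6 6)) V′ cover
        = extract (y ∸ T * u) V″ small V″-low λ (L′ , L′⊆ , L′-rainbow , L′-col , y′≤) →
            k (L ++ L′ , ++⊆ L′⊆ , rainbow L′⊆ L′-rainbow , colourable-++ L-col L′-col ,
               (begin
                 y                          ≤⟨ m≤n+m∸n y (T * u) ⟩
                 T * u + (y ∸ T * u)        ≤⟨ +-mono-≤ (≤-reflexive (sym L-len)) y′≤ ⟩
                 length L + (length L′ + N₀) ≡⟨ sym (+-assoc (length L) _ _) ⟩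
                 length L + length L′ + N₀  ≡⟨ cong (_+ N₀) (sym (length-++ L)) ⟩
                 length (L ++ L′) + N₀      ∎))
        where
        used? : Decidable (λ v → σ v ∈ map σ L)
        used? v = σ v ∈ᶜ? map σ L
        V″ = filter (¬? ∘ used?) V′
        V″-spec : ∀ {v} → v ∈ V″ → v ∈ V′ × σ v ∉ map σ L
        V″-spec v∈ = ∈-filter⁻ (¬? ∘ used?) {xs = V′} v∈
        V″-low : Lower V″ (y ∸ T * u)
        -- Restoring the deleted colours of `L` costs `length L`, which equals `T * u`.
        V″-low {j} V″-col = m≤n+o⇒m∸n≤o y (T * u) (V′-low (colourable-partition used?
          (subst (Colourable _) (trans (length-map σ L) L-len)
            (colourable-by-colours (λ v∈ → proj₂ (∈-filter⁻ used? {xs = V′} v∈)))) V″-col))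
        small : y ∸ T * u ≤ 2 ^ (10 * e)
        small = begin
          y ∸ T * u                    ≤⟨ leftover u (1 + (ℓ + ℓ)) T y y≤u¹⁰
                                            (subst (λ R → y ≤ T * (u + (1 + (ℓ + ℓ))) + R)
                                              (*-assoc u u (u * u ^ 6)) (V′-low V′-col′)) ⟩
          u ^ 9 * suc (1 + (ℓ + ℓ))    ≤⟨ *-monoʳ-≤ (u ^ 9) C≤ ⟩
          u ^ 9 * 2 ^ c                ≡⟨ cong (_* 2 ^ c) (sym (power 9)) ⟩
          2 ^ (9 * e′) * 2 ^ c         ≡⟨ sym (^-distribˡ-+-* 2 (9 * e′) c) ⟩
          2 ^ (9 * e′ + c)             ≤⟨ ^-monoʳ-≤ 2 e≤ ⟩
          2 ^ (10 * e)                 ∎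
        ++⊆ : ∀ {L′} → L′ ⊆ V″ → L ++ L′ ⊆ V
        ++⊆ L′⊆ v∈ with ∈-++⁻ L v∈
        ... | inj₁ v∈L  = V′⊆V (L⊆V′ v∈L)
        ... | inj₂ v∈L′ = V′⊆V (proj₁ (V″-spec (L′⊆ v∈L′)))
        rainbow : ∀ {L′} → L′ ⊆ V″ → Rainbow L′ → Rainbow (L ++ L′)
        rainbow {L′} L′⊆ L′-rainbow =
          subst Unique (sym (map-++ σ L L′)) (Unique.++⁺ L-rainbow L′-rainbow disjoint)
          where
          disjoint : ∀ {c} → ¬ (c ∈ map σ L × c ∈ map σ L′)
          disjoint (c∈L , c∈L′) with ∈-map⁻ σ c∈L′
          ... | v , v∈L′ , refl = proj₂ (V″-spec (L′⊆ v∈L′)) c∈L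

    module _ {c : ℕ} (C≤ : suc (1 + (ℓ + ℓ)) ≤ 2 ^ c) (N₀≡ : N₀ ≡ 2 ^ (10 * (c * 10))) where

      -- Each round raises the exponent by `h`. This is affordable since `10 * h * (i + 10)` exceeds
      -- `9 * h * (i + 11)` by `h * (i + 1)`, which is at least `c`.
      climb : ∀ {h f} → c ≤ h → Extracts (h * 10) f → ∀ i → Extracts (h * (i + 10)) (i + f)
      climb c≤h extract zero = extract
      climb {h} {f} c≤h extract (suc i) =
        advance {e = h * (i + 10)} {h * (suc i + 10)} {i + f} C≤ enough (climb {h} {f} c≤h extract i)
        where
        open ≤-Reasoning
        rearrange : ∀ h i → 9 * (h * (suc i + 10)) + h + i * h ≡ 10 * (h * (i + 10))
        rearrange = solve-∀
        enough : 9 * (h * (suc i + 10)) + c ≤ 10 * (h * (i + 10))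
        enough = begin
          9 * (h * (suc i + 10)) + c         ≤⟨ +-monoʳ-≤ (9 * (h * (suc i + 10))) c≤h ⟩
          9 * (h * (suc i + 10)) + h         ≤⟨ m≤m+n _ (i * h) ⟩
          9 * (h * (suc i + 10)) + h + i * h ≡⟨ rearrange h i ⟩
          10 * (h * (i + 10))                ∎

      -- Ten steps of size `h` take `h * 10` to `h * 20`, so ten rounds double the exponent. In the
      -- base case `y` is at most `N₀` and the empty list suffices.
      extracts : ∀ g → Extracts (2 ^ g * c * 10) (g * 10)
      extracts zero y V y≤ _ k = k ([] , (λ ()) , [] , colourable-[] ,
        ≤-trans y≤ (≤-reflexive (trans (cong (λ h → 2 ^ (10 * (h * 10))) (*-identityˡ c)) (sym N₀≡))))
      extracts (suc g) = subst (λ e → Extracts e (suc g * 10)) (double (2 ^ g) c)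
        (climb {2 ^ g * c} {g * 10} (m≤n*m c (2 ^ g) {{m^n≢0 2 g}}) (extracts g) 10)
        where
        double : ∀ x c → x * c * 20 ≡ 2 * x * c * 10
        double = solve-∀

-- From vertex lists to the chromatic discrepancy.

module _ {n} (G : Graph n) where

  open Colouring G
  open import Data.List.Membership.DecPropositional (Fin._≟_ {n}) using (_∈?_)

  -- `ColourableOn` colours every vertex of the graph, so a vertex of `V` is needed to supply a
  -- default colour.
  colourable⇒ColourableOn : ∀ {V S j} → (∃[ v ] v ∈ V) → (∀ {v} → v Subset.∈ S → v ∈ V) →
                            Colourable V j → ColourableOn G S j
  colourable⇒ColourableOn {V} (v , v∈) S⊆V (c , c< , c≢)
    with c′ , spec ← choose {R = λ v i → toℕ i ≡ c v} (fromℕ< (c< v∈)) V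
                       (λ u∈ → fromℕ< (c< u∈) , Fin.toℕ-fromℕ< (c< u∈))
    = c′ , λ u w u∈ w∈ u~w eq → c≢ (S⊆V u∈) (S⊆V w∈) u~w
             (trans (sym (spec (S⊆V u∈))) (trans (cong toℕ eq) (spec (S⊆V w∈))))

  subset : List V# → Subset n
  subset L = Vec.tabulate λ v → does (v ∈? L)

  ∈-subset⁺ : ∀ {L v} → v ∈ L → v Subset.∈ subset L
  ∈-subset⁺ {L} {v} v∈ = lookup⇒[]= v (subset L) (trans (lookup∘tabulate _ v) (dec-true (v ∈? L) v∈))

  ∈-subset⁻ : ∀ {L v} → v Subset.∈ subset L → v ∈ L
  ∈-subset⁻ {L} {v} v∈ with v ∈? L | trans (sym (lookup∘tabulate (λ v → does (v ∈? L)) v)) ([]=⇒lookup v∈)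
  ... | yes v∈L | _  = v∈L
  ... | no  _   | ()

  -- `φ` is applied to the subgraph induced by `L`, which shows `length L` colours. Its exact
  -- chromatic number exists only under double negation, which the decidable goal removes.
  rainbow-bound : ∀ {σ d} → PhiSigma G σ d →
                  ∀ L {j} → Unique (map σ L) → Colourable L j → length L ≤ j + d
  -- `PhiSigma` ranges over non-empty sets, so the empty list is separate.
  rainbow-bound {σ} {d} φ []        {j} _       _     = z≤n
  rainbow-bound {σ} {d} φ L@(v ∷ _) {j} rainbow L-col = decidable-stable (length L ≤? j + d) λ ≰ →
    least (ColourableOn G (subset L)) (colourable⇒ColourableOn (v , here refl) (∈-subset⁻ {L}) L-col)
      λ (c , c≤j , col , low) → ≰ (begin
        length L           ≤⟨ m≤n+m∸n (length L) c ⟩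
        c + (length L ∸ c) ≤⟨ +-mono-≤ c≤j (proj₂ φ (subset L) (length L) c
                                               (v , ∈-subset⁺ {L} (here refl)) image (col , low)) ⟩
        j + d              ∎)
    where
    open ≤-Reasoning
    image : ImageSize σ (subset L) (length L)
    image = σ ∘ List.lookup L , lookup-injective σ (AllPairs.map⁻ rainbow) ,
      (λ u u∈ → let u∈L = ∈-subset⁻ {L} u∈ in Any.index u∈L , cong σ (sym (lookup-index u∈L))) ,
      λ i → List.lookup L i , ∈-subset⁺ {L} (∈-lookup i) , refl

-- A colouring attaining φ(G) is fixed, and the list extracted from all vertices in `g * 10` rounds
-- is fed to `rainbow-bound`.
discrepancy-bound : ∀ {a n} (G : Graph (suc n)) → ¬ ContainsCycle G (5 + a) →
  ∀ {c N₀} → suc (1 + (4 + a + (4 + a))) ≤ 2 ^ c → N₀ ≡ 2 ^ (10 * (c * 10)) →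
  ∀ {k d} → ChromaticNumber G k → Phi G d →
  ∀ g → k ≤ 2 ^ (10 * (2 ^ g * c * 10)) → k ≤ g * 10 * (4 + a) + d + N₀
discrepancy-bound {a} {n} G acyclic {c} {N₀} C≤ N₀≡ {k} {d} (_ , k-low) ((σ , proper , φ) , _) g k≤ =
  decidable-stable (k ≤? g * 10 * (4 + a) + d + N₀) λ ≰ →
    Extraction.extracts G σ proper acyclic N₀ C≤ N₀≡ g k (allFin (suc n)) k≤
      (λ col → k-low _ (colourable⇒ColourableOn G (zero , ∈-allFin zero) (λ {v} _ → ∈-allFin v) col))
      λ (L , _ , rainbow , L-col , k≤L) →
        ≰ (≤-trans k≤L (+-monoˡ-≤ N₀ (rainbow-bound G φ L rainbow L-col)))

-- Choice of the constants.

-- For `l` at least 1, `suc l` is at most `2 * l` and `N₀` at most `N₀ * l`.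
absorb : ∀ ℓ l N₀ d → 1 ≤ l → suc l * 10 * ℓ + d + N₀ ≤ d + (20 * ℓ + N₀) * l
absorb ℓ (suc l) N₀ d _ =
  subst (suc (suc l) * 10 * ℓ + d + N₀ ≤_) (expand l ℓ d N₀) (m≤m+n _ (l * 10 * ℓ + N₀ * l))
  where
  expand : ∀ l ℓ d N₀ → suc (suc l) * 10 * ℓ + d + N₀ + (l * 10 * ℓ + N₀ * l) ≡
                        d + (20 * ℓ + N₀) * suc l
  expand = solve-∀

-- Two uses of `n<2^[1+⌊log₂n⌋]` show that one more doubling than the iterated logarithm reaches
-- `k`.
tower : ∀ c k .{{_ : NonZero c}} → k ≤ 2 ^ (10 * (2 ^ suc ⌊log₂ ⌊log₂ k ⌋ ⌋ * c * 10))
tower c k = begin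
  k                               ≤⟨ <⇒≤ (n<2^[1+⌊log₂n⌋] k) ⟩
  2 ^ suc ⌊log₂ k ⌋               ≤⟨ ^-monoʳ-≤ 2 (n<2^[1+⌊log₂n⌋] ⌊log₂ k ⌋) ⟩
  2 ^ x                           ≤⟨ ^-monoʳ-≤ 2 (≤-trans (m≤m*n x c) (≤-trans (m≤m*n (x * c) 10) (m≤n*m _ 10))) ⟩
  2 ^ (10 * (x * c * 10))         ∎
  where
  open ≤-Reasoning
  x = 2 ^ suc ⌊log₂ ⌊log₂ k ⌋ ⌋

discrepancy-loglog : ∀ a c N₀ .{{_ : NonZero c}} →
  suc (1 + (4 + a + (4 + a))) ≤ 2 ^ c → N₀ ≡ 2 ^ (10 * (c * 10)) →
  ∀ (n : ℕ) (G : Graph (suc n)) → ¬ ContainsCycle G (5 + a) →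
  ∀ (k d : ℕ) → ChromaticNumber G k → Phi G d → 4 ≤ k →
  k ≤ d + (20 * (4 + a) + N₀) * ⌊log₂ ⌊log₂ k ⌋ ⌋
discrepancy-loglog a c N₀ C≤ N₀≡ n G acyclic k d χ φ 4≤k =
  ≤-trans (discrepancy-bound G acyclic C≤ N₀≡ χ φ (suc ⌊log₂ ⌊log₂ k ⌋ ⌋) (tower c k))
          -- `4 ≤ k` makes the iterated logarithm at least 1.
          (absorb (4 + a) ⌊log₂ ⌊log₂ k ⌋ ⌋ N₀ d (⌊log₂⌋-mono-≤ {2} (⌊log₂⌋-mono-≤ {4} 4≤k)))

discrepancy-constants : ∀ a c .{{_ : NonZero c}} → suc (1 + (4 + a + (4 + a))) ≤ c →
  ∃[ C ] ∃[ N ] ∀ (n : ℕ) (G : Graph (suc n)) → ¬ ContainsCycle G (5 + a) →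
  ∀ (k d : ℕ) → ChromaticNumber G k → Phi G d → N ≤ k →
  k ≤ d + C * ⌊log₂ ⌊log₂ k ⌋ ⌋
discrepancy-constants a c C≤ =
  20 * (4 + a) + 2 ^ (10 * (c * 10)) , 4 , discrepancy-loglog a c _ (≤-trans C≤ (n≤2^n c)) refl

theorem1p12 : ∀ (ℓ : ℕ) → 4 ≤ ℓ →
    ∃[ C ] ∃[ N ] ∀ (n : ℕ) (G : Graph (suc n)) →
    ¬ ContainsCycle G (suc ℓ) →
    ∀ (k d : ℕ) → ChromaticNumber G k → Phi G d → N ≤ k →
    k ≤ d + C * ⌊log₂ ⌊log₂ k ⌋ ⌋
theorem1p12 (suc (suc (suc (suc a)))) (s≤s (s≤s (s≤s (s≤s z≤n)))) =
  -- `c` is 2ℓ + 2, and `n≤2^n` then gives the required 2ℓ + 2 ≤ 2^c.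
  discrepancy-constants a (suc (1 + (4 + a + (4 + a)))) ≤-refl
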